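{- Let $(G,\precsim)$ be a C-quasi-ordered group and let $1\neq g\in G$ be o-type. Then both $G^g$ and $G_g$ are subgroups of $G$. Moreover, $G^g$ is convex and $G_g$ is the smallest normal strictly convex subgroup of $G^g$ such that the quasi-order induced by $\precsim$ on $G^g/G_g$ is order-type.
   Context: A quasi-order is a reflexive, transitive and total binary relation $\precsim$; $a\sim b$ means $a\precsim b\precsim a$, and $a\precnsim b$ means $a\precsim b$ and $a\nsim b$. An element $c$ is between $a$ and $b$ if $a\precsim c\precsim b$ or $b\precsim c\precsim a$. A subset $S$ is convex (resp. strictly convex) if for all $s,t\in S$, $s\precsim a\precsim t$ (resp. $s\precnsim a\precnsim t$) implies $a\in S$. A C-relation on a set is a ternary relation $C$ such that for all $x,y,z,w$: $C(x,y,z)\Rightarrow C(x,z,y)$; $C(x,y,z)\Rightarrow\neg C(y,x,z)$; $C(x,y,z)\Rightarrow C(w,y,z)\vee C(x,w,z)$; $x\neq y\Rightarrow C(x,y,y)$. On a group it is compatible if $C(x,y,z)$ implies $C(vxu,vyu,vzu)$ for all $x,y,z,u,v$. A C-quasi-order on a group $G$ is a quasi-order of the form $x\precsim y\Leftrightarrow\neg C(x,y,1)$ with $C$ a compatible C-relation (then unique: $C(x,y,z)\Leftrightarrow yz^{ -1}\precnsim xz^{ -1}$); a C-quasi-ordered group is a group with a C-quasi-order. It is order-type if its C-relation is $C(x,y,z)\Leftrightarrow(y<x\wedge z<x)\vee(y=z\neq x)$ for some total order $\leq$ making the group an ordered group ($x\leq y$ implies $xz\leq yz$ and $zx\leq zy$).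 If $H$ is a strictly convex normal subgroup of a C-quasi-ordered group $(K,\precsim)$, the C-quasi-order induced on $K/H$ is $aH\precsim bH\Leftrightarrow a\in H\vee(b\notin H\wedge a\precsim b)$. $g$ is o-type if $g=1$ or $g\nsim g^{ -1}$; $o^+$-type if $g^{ -1}\precnsim g$; $o^-$-type if $g\precnsim g^{ -1}$. For $g$ $o^+$-type, $T_g^+$ is the set of $o^+$-type elements $h$ such that every element between $g$ and $h$ is $o^+$-type, $T_g:=T_g^+\cup(T_g^+)^{ -1}$, $G_g:=\{h\mid\{h,h^{ -1}\}\precsim g^{ -1}\}$ (i.e. $h\precsim g^{ -1}$ and $h^{ -1}\precsim g^{ -1}$). For $g$ $o^-$-type, $T_g:=T_{g^{ -1}}$ and $G_g:=G_{g^{ -1}}$. In both cases $G^g:=G_g\cup T_g$. -}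

module Defs where

open import Level using (Level; _⊔_; suc)
open import Algebra.Bundles using (Group)
import Algebra.Properties.Group as GroupProperties
open import Data.Product using (Σ; _×_; _,_; proj₁; ∃-syntax)
open import Data.Sum using (_⊎_)
open import Function using (_⇔_; _on_)
open import Relation.Binary
  using (Rel; Setoid; IsTotalPreorder; IsTotalOrder)
open import Relation.Nullary using (¬_)
open import Relation.Unary using (Pred; _∈_; _∉_; _⊆_; _∪_)

private
  variable
    a c ℓ r p : Level

module QuasiOrder {A : Set a} (_≲_ : Rel A r) where

  infix 4 _∼_ _⋨_

  _∼_ : Rel A r
  x ∼ y = x ≲ y × y ≲ x

  _⋨_ : Rel A r
  x ⋨ y = x ≲ y × ¬ (x ∼ y)

  _isBetween_and_ : A → A → A → Set r
  z isBetween x and y = (x ≲ z × z ≲ y) ⊎ (y ≲ z × z ≲ x)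

  Convex : Pred A p → Set (a ⊔ r ⊔ p)
  Convex S = ∀ {s t x} → s ∈ S → t ∈ S → s ≲ x → x ≲ t → x ∈ S

  StrictlyConvex : Pred A p → Set (a ⊔ r ⊔ p)
  StrictlyConvex S = ∀ {s t x} → s ∈ S → t ∈ S → s ⋨ x → x ⋨ t → x ∈ S

-- Sets are setoids here, so a C-relation must also respect the equality.
module _ (A : Setoid a ℓ) where
  open Setoid A

  record IsCRelation (C : Carrier → Carrier → Carrier → Set r)
                     : Set (a ⊔ ℓ ⊔ r) where
    field
      resp   : ∀ {x x′ y y′ z z′} → x ≈ x′ → y ≈ y′ → z ≈ z′ →
               C x y z → C x′ y′ z′
      swap   : ∀ {x y z} → C x y z → C x z y
      asym   : ∀ {x y z} → C x y z → ¬ C y x z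
      branch : ∀ {x y z} w → C x y z → C w y z ⊎ C x w z
      proper : ∀ {x y} → ¬ (x ≈ y) → C x y y

module _ (G : Group c ℓ) where
  open Group G

  Compatible : (Carrier → Carrier → Carrier → Set r) → Set (c ⊔ r)
  Compatible C = ∀ {x y z} v u → C x y z →
                 C (v ∙ x ∙ u) (v ∙ y ∙ u) (v ∙ z ∙ u)

  -- Since C x y z ⇔ (y ∙ z ⁻¹) ⋨ (x ∙ z ⁻¹), taking C in the universe of _≲_
  -- is no restriction.
  record IsCQuasiOrder (_≲_ : Rel Carrier r) : Set (c ⊔ ℓ ⊔ suc r) where
    field
      isTotalPreorder : IsTotalPreorder _≈_ _≲_
      C               : Carrier → Carrier → Carrier → Set r
      isCRelation     : IsCRelation setoid C
      compatible      : Compatible C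
      ≲⇔¬C            : ∀ x y → (x ≲ y) ⇔ (¬ C x y ε)

  record IsGroupOrder (_≤_ : Rel Carrier r) : Set (c ⊔ ℓ ⊔ r) where
    field
      isTotalOrder : IsTotalOrder _≈_ _≤_
      ∙-monoʳ      : ∀ {x y} z → x ≤ y → (x ∙ z) ≤ (y ∙ z)
      ∙-monoˡ      : ∀ {x y} z → x ≤ y → (z ∙ x) ≤ (z ∙ y)

  -- For ≤ as below and z ≉ ε, one has ε < z ⇔ C z (z ⁻¹) ε, and
  -- x < y ⇔ ε < y ∙ x ⁻¹; hence ≤ can always be taken at level ℓ ⊔ r.
  record IsOrderType (_≲_ : Rel Carrier r) : Set (suc (c ⊔ ℓ ⊔ r)) where
    field
      isCQuasiOrder : IsCQuasiOrder _≲_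
      _≤_           : Rel Carrier (ℓ ⊔ r)
      isGroupOrder  : IsGroupOrder _≤_

    open IsCQuasiOrder isCQuasiOrder public

    _<_ : Rel Carrier (ℓ ⊔ r)
    x < y = x ≤ y × ¬ (x ≈ y)

    field
      C⇔ : ∀ x y z →
           C x y z ⇔ (((y < x) × (z < x)) ⊎ ((y ≈ z) × ¬ (z ≈ x)))

module _ (G : Group c ℓ) where
  open Group G

  record IsSubgroup (H : Pred Carrier p) : Set (c ⊔ ℓ ⊔ p) where
    field
      resp      : ∀ {x y} → x ≈ y → x ∈ H → y ∈ H
      ε-closed  : ε ∈ H
      ∙-closed  : ∀ {x y} → x ∈ H → y ∈ H → (x ∙ y) ∈ H
      ⁻¹-closed : ∀ {x} → x ∈ H → (x ⁻¹) ∈ H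

  record IsNormalSubgroup (H : Pred Carrier p) : Set (c ⊔ ℓ ⊔ p) where
    field
      isSubgroup  : IsSubgroup H
      conj-closed : ∀ {h} x → h ∈ H → (x ∙ h ∙ x ⁻¹) ∈ H

    open IsSubgroup isSubgroup public

  subgroup : {H : Pred Carrier p} → IsSubgroup H → Group (c ⊔ p) ℓ
  subgroup {H = H} isSub = record
    { Carrier = Σ Carrier H
    ; _≈_     = _≈_ on proj₁
    ; _∙_     = λ (x , hx) (y , hy) → (x ∙ y) , ∙-closed hx hy
    ; ε       = ε , ε-closed
    ; _⁻¹     = λ (x , hx) → (x ⁻¹) , ⁻¹-closed hx
    ; isGroup = record
      { isMonoid = record
        { isSemigroup = record
          { isMagma = record
            { isEquivalence = record { refl = refl ; sym = sym ; trans = trans }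
            ; ∙-cong        = ∙-cong
            }
          ; assoc = λ (x , _) (y , _) (z , _) → assoc x y z
          }
        ; identity = (λ (x , _) → identityˡ x) , (λ (x , _) → identityʳ x)
        }
      ; inverse = (λ (x , _) → inverseˡ x) , (λ (x , _) → inverseʳ x)
      ; ⁻¹-cong = ⁻¹-cong
      }
    }
    where open IsSubgroup isSub

  -- The quotient keeps the carrier of G; x and y are identified when
  -- xH = yH, that is x ⁻¹ ∙ y ∈ H.
  quotient : {H : Pred Carrier p} → IsNormalSubgroup H → Group c p
  quotient {p = p} {H = H} isNormal = record
    { Carrier = Carrier
    ; _≈_     = _≈ᴴ_
    ; _∙_     = _∙_
    ; ε       = ε
    ; _⁻¹     = _⁻¹
    ; isGroup = record
      { isMonoid = record
        { isSemigroup = record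
          { isMagma = record
            { isEquivalence = record
              { refl = λ {x} → ≈⇒≈ᴴ (refl {x}) ; sym = ≈ᴴ-sym ; trans = ≈ᴴ-trans }
            ; ∙-cong = ≈ᴴ-∙-cong
            }
          ; assoc = λ x y z → ≈⇒≈ᴴ (assoc x y z)
          }
        ; identity = (λ x → ≈⇒≈ᴴ (identityˡ x)) , (λ x → ≈⇒≈ᴴ (identityʳ x))
        }
      ; inverse = (λ x → ≈⇒≈ᴴ (inverseˡ x)) , (λ x → ≈⇒≈ᴴ (inverseʳ x))
      ; ⁻¹-cong = ≈ᴴ-⁻¹-cong
      }
    }
    where
    open IsNormalSubgroup isNormal
    open GroupProperties G
    open import Relation.Binary.Reasoning.Setoid setoid

    _≈ᴴ_ : Rel Carrier p
    x ≈ᴴ y = (x ⁻¹ ∙ y) ∈ H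

    ≈⇒≈ᴴ : ∀ {x y} → x ≈ y → x ≈ᴴ y
    ≈⇒≈ᴴ {x} {y} x≈y =
      resp (trans (sym (inverseˡ x)) (∙-congˡ x≈y)) ε-closed

    ≈ᴴ-sym : ∀ {x y} → x ≈ᴴ y → y ≈ᴴ x
    ≈ᴴ-sym {x} {y} h = resp (⁻¹-anti-homo-\\ x y) (⁻¹-closed h)

    ≈ᴴ-trans : ∀ {x y z} → x ≈ᴴ y → y ≈ᴴ z → x ≈ᴴ z
    ≈ᴴ-trans {x} {y} {z} h k = resp eq (∙-closed h k)
      where
      eq : (x ⁻¹ ∙ y) ∙ (y ⁻¹ ∙ z) ≈ x ⁻¹ ∙ z
      eq = begin
        (x ⁻¹ ∙ y) ∙ (y ⁻¹ ∙ z) ≈⟨ assoc _ _ _ ⟩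
        x ⁻¹ ∙ (y ∙ (y ⁻¹ ∙ z)) ≈⟨ ∙-congˡ (\\-leftDividesˡ y z) ⟩
        x ⁻¹ ∙ z                ∎

    conj⁻¹-closed : ∀ {h} x → h ∈ H → (x ⁻¹ ∙ h ∙ x) ∈ H
    conj⁻¹-closed x h = resp (∙-congˡ (⁻¹-involutive x)) (conj-closed (x ⁻¹) h)

    ≈ᴴ-∙-cong : ∀ {x y u v} → x ≈ᴴ y → u ≈ᴴ v → (x ∙ u) ≈ᴴ (y ∙ v)
    ≈ᴴ-∙-cong {x} {y} {u} {v} h k = resp eq (∙-closed (conj⁻¹-closed u h) k)
      where
      eq : (u ⁻¹ ∙ (x ⁻¹ ∙ y) ∙ u) ∙ (u ⁻¹ ∙ v) ≈ (x ∙ u) ⁻¹ ∙ (y ∙ v)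
      eq = begin
        (u ⁻¹ ∙ (x ⁻¹ ∙ y) ∙ u) ∙ (u ⁻¹ ∙ v) ≈⟨ assoc _ _ _ ⟩
        u ⁻¹ ∙ (x ⁻¹ ∙ y) ∙ (u ∙ (u ⁻¹ ∙ v)) ≈⟨ ∙-congˡ (\\-leftDividesˡ u v) ⟩
        u ⁻¹ ∙ (x ⁻¹ ∙ y) ∙ v                ≈⟨ ∙-congʳ (assoc _ _ _) ⟨
        u ⁻¹ ∙ x ⁻¹ ∙ y ∙ v                  ≈⟨ ∙-congʳ (∙-congʳ (⁻¹-anti-homo-∙ x u)) ⟨
        (x ∙ u) ⁻¹ ∙ y ∙ v                   ≈⟨ assoc _ _ _ ⟩
        (x ∙ u) ⁻¹ ∙ (y ∙ v)                 ∎

    ≈ᴴ-⁻¹-cong : ∀ {x y} → x ≈ᴴ y → (x ⁻¹) ≈ᴴ (y ⁻¹)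
    ≈ᴴ-⁻¹-cong {x} {y} h = resp eq (conj-closed x (≈ᴴ-sym h))
      where
      eq : x ∙ (y ⁻¹ ∙ x) ∙ x ⁻¹ ≈ (x ⁻¹) ⁻¹ ∙ y ⁻¹
      eq = begin
        x ∙ (y ⁻¹ ∙ x) ∙ x ⁻¹ ≈⟨ assoc _ _ _ ⟩
        x ∙ (y ⁻¹ ∙ x ∙ x ⁻¹) ≈⟨ ∙-congˡ (//-rightDividesʳ x (y ⁻¹)) ⟩
        x ∙ y ⁻¹              ≈⟨ ∙-congʳ (⁻¹-involutive x) ⟨
        (x ⁻¹) ⁻¹ ∙ y ⁻¹      ∎

module _ (K : Group c ℓ) (_≲_ : Rel (Group.Carrier K) r) where
  open Group K
  open QuasiOrder _≲_

  inducedOnQuotient : Pred Carrier p → Rel Carrier (r ⊔ p)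
  inducedOnQuotient H x y = x ∈ H ⊎ (y ∉ H × x ≲ y)

  record HasOrderTypeQuotient (H : Pred Carrier p) : Set (suc (c ⊔ r ⊔ p) ⊔ ℓ) where
    field
      isNormalSubgroup : IsNormalSubgroup K H
      strictlyConvex   : StrictlyConvex H
      isOrderType      : IsOrderType (quotient K isNormalSubgroup)
                                     (inducedOnQuotient H)

module ElementTypes (G : Group c ℓ) (_≲_ : Rel (Group.Carrier G) r) where
  open Group G
  open QuasiOrder _≲_ public

  OType : Pred Carrier (ℓ ⊔ r)
  OType g = (g ≈ ε) ⊎ ¬ (g ∼ g ⁻¹)

  O⁺Type : Pred Carrier r
  O⁺Type g = g ⁻¹ ⋨ g

  O⁻Type : Pred Carrier r
  O⁻Type g = g ⋨ g ⁻¹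

  Inverse : Pred Carrier p → Pred Carrier (c ⊔ ℓ ⊔ p)
  Inverse S h = ∃[ k ] (k ∈ S × h ≈ k ⁻¹)

  -- T⁺ g, T₊ g and G₊ g are T_g⁺, T_g and G_g for g of o⁺-type.
  T⁺ : Carrier → Pred Carrier (c ⊔ r)
  T⁺ g h = O⁺Type h × (∀ x → x isBetween g and h → O⁺Type x)

  T₊ : Carrier → Pred Carrier (c ⊔ ℓ ⊔ r)
  T₊ g = T⁺ g ∪ Inverse (T⁺ g)

  G₊ : Carrier → Pred Carrier r
  G₊ g h = (h ≲ (g ⁻¹)) × ((h ⁻¹) ≲ (g ⁻¹))

  -- T g and G↓ g (written G_g) are defined by cases on the type of g, and are
  -- only meaningful when g is of o⁺- or o⁻-type; they are empty otherwise.
  T : Carrier → Pred Carrier (c ⊔ ℓ ⊔ r)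
  T g h = (O⁺Type g × h ∈ T₊ g) ⊎ (O⁻Type g × h ∈ T₊ (g ⁻¹))

  G↓ : Carrier → Pred Carrier r
  G↓ g h = (O⁺Type g × h ∈ G₊ g) ⊎ (O⁻Type g × h ∈ G₊ (g ⁻¹))

  -- Written with a superscript: Gᵍ = G_g ∪ T_g.
  G↑ : Carrier → Pred Carrier (c ⊔ ℓ ⊔ r)
  G↑ g = G↓ g ∪ T g

{-# OPTIONS --safe #-}

-- Replacing g by its inverse, assume g ⁻¹ ⋨ g, and let N = {x | x ≲ g ⁻¹}.
-- The compatible C-relation makes N a submonoid, and T⁺ g turns out to be
-- {h | h ⁻¹ ≲ g ⁻¹ ⋨ h}; hence G_g = N ∩ N⁻¹ and Gᵍ = N ∪ N⁻¹. As N is normal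
-- in Gᵍ, it is the cone of elements ≤ ε of an order on Gᵍ / G_g, namely
-- x ≤ y iff y ⁻¹ ∙ x ∈ N, and this order induces the quotient of ≲.
-- Conversely, let M be normal and strictly convex in Gᵍ with an order-type
-- quotient. If g ∈ M then G_g ⊆ M by strict convexity. Otherwise g ⁻¹ is negative
-- in the quotient, so no h ≲ g ⁻¹ is positive there; applied to h and h ⁻¹,
-- this gives G_g ⊆ M.
module Submission where

open import Defs
open import Level using (Level; _⊔_; Lift; lift; lower)
open import Algebra.Bundles using (Group)
import Algebra.Properties.Group as GroupProperties
open import Axiom.ExcludedMiddle using (ExcludedMiddle)
open import Data.Product using (Σ; _×_; _,_; proj₁; proj₂; map; swap)
open import Data.Sum using (_⊎_; inj₁; inj₂)
  renaming ([_,_]′ to [_,_]; map to ⊎-map; swap to ⊎-swap)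
open import Function using (_on_; _∘_; id; _⇔_; mk⇔; Equivalence)
open import Relation.Binary using (Rel; IsTotalPreorder; IsTotalOrder)
open import Relation.Nullary using (¬_; yes; no; contradiction)
open import Relation.Nullary.Decidable using (map′; decidable-stable)
open import Relation.Unary using (Pred; _∈_; _∉_; _⊆_; _≐_)

lower-em : ∀ {a} b → ExcludedMiddle (a ⊔ b) → ExcludedMiddle a
lower-em b em {P} = map′ lower lift (em {Lift b P})

-- Order-type C-relations from ordered groups.

module OrderedGroup {c ℓ r} (em : ExcludedMiddle (ℓ ⊔ r)) (G : Group c ℓ)
                    {_≤_ : Rel (Group.Carrier G) (ℓ ⊔ r)}
                    (isGroupOrder : IsGroupOrder G _≤_) where
  open Group G
  open GroupProperties G
  open IsGroupOrder isGroupOrder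
  open IsTotalOrder isTotalOrder using (antisym; total; ≤-respˡ-≈; ≤-respʳ-≈)
    renaming (reflexive to ≤-reflexive; trans to ≤-trans)

  _<_ : Rel Carrier (ℓ ⊔ r)
  x < y = x ≤ y × ¬ (x ≈ y)

  C : Carrier → Carrier → Carrier → Set (ℓ ⊔ r)
  C x y z = ((y < x) × (z < x)) ⊎ ((y ≈ z) × ¬ (z ≈ x))

  <-resp : ∀ {x x′ y y′} → x ≈ x′ → y ≈ y′ → x < y → x′ < y′
  <-resp x≈x′ y≈y′ (x≤y , x≉y) =
    ≤-respˡ-≈ x≈x′ (≤-respʳ-≈ y≈y′ x≤y) ,
    λ x′≈y′ → x≉y (trans x≈x′ (trans x′≈y′ (sym y≈y′)))

  <-asym : ∀ {x y} → x < y → ¬ (y < x)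
  <-asym (x≤y , x≉y) (y≤x , _) = x≉y (antisym x≤y y≤x)

  <-≤-trans : ∀ {x y z} → x < y → y ≤ z → x < z
  <-≤-trans (x≤y , x≉y) y≤z =
    ≤-trans x≤y y≤z , λ x≈z → x≉y (antisym x≤y (≤-respʳ-≈ (sym x≈z) y≤z))

  <-∙-mono : ∀ {x y} v u → x < y → (v ∙ x ∙ u) < (v ∙ y ∙ u)
  <-∙-mono v u (x≤y , x≉y) =
    ∙-monoʳ u (∙-monoˡ v x≤y) ,
    λ eq → x≉y (∙-cancelˡ v _ _ (∙-cancelʳ u _ _ eq))

  ≮⇒≥ : ∀ {x y} → ¬ (x < y) → y ≤ x
  ≮⇒≥ {x} {y} x≮y with total x y
  ... | inj₂ y≤x = y≤x
  ... | inj₁ x≤y = ≤-reflexive (sym x≈y)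
    where x≈y = decidable-stable (lower-em r em) (λ x≉y → x≮y (x≤y , x≉y))

  isCRelation : IsCRelation setoid C
  isCRelation = record
    { resp   = λ x≈ y≈ z≈ → ⊎-map
        (map (<-resp y≈ x≈) (<-resp z≈ x≈))
        (map (λ y≈z → trans (sym y≈) (trans y≈z z≈))
             (λ z≉x z′≈x′ → z≉x (trans z≈ (trans z′≈x′ (sym x≈)))))
    ; swap   = ⊎-map swap
        (λ (y≈z , z≉x) → sym y≈z , λ y≈x → z≉x (trans (sym y≈z) y≈x))
    ; asym   = C-asym
    ; branch = C-branch
    ; proper = λ x≉y → inj₂ (refl , λ y≈x → x≉y (sym y≈x))
    }
    where
    C-asym : ∀ {x y z} → C x y z → ¬ C y x z
    C-asym (inj₁ (y<x , _))     (inj₁ (x<y , _))     = <-asym x<y y<x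
    C-asym (inj₁ (_ , _ , z≉x)) (inj₂ (x≈z , _))     = z≉x (sym x≈z)
    C-asym (inj₂ (y≈z , _))     (inj₁ (_ , _ , z≉y)) = z≉y (sym y≈z)
    C-asym (inj₂ (_ , z≉x))     (inj₂ (x≈z , _))     = z≉x (sym x≈z)

    C-branch : ∀ {x y z} w → C x y z → C w y z ⊎ C x w z
    -- Either `w` is below `x`, or it is at least `x` and so strictly above `y` and `z` as well.
    C-branch {x} w (inj₁ (y<x , z<x)) with em {w < x}
    ... | yes w<x = inj₂ (inj₁ (w<x , z<x))
    ... | no  w≮x = inj₁ (inj₁ (<-≤-trans y<x (≮⇒≥ w≮x) , <-≤-trans z<x (≮⇒≥ w≮x)))
    C-branch {z = z} w (inj₂ (y≈z , z≉x)) with lower-em r em {w ≈ z}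
    ... | yes w≈z = inj₂ (inj₂ (w≈z , z≉x))
    ... | no  w≉z = inj₁ (inj₂ (y≈z , λ z≈w → w≉z (sym z≈w)))

  compatible : Compatible G C
  compatible v u = ⊎-map
    (map (<-∙-mono v u) (<-∙-mono v u))
    (map (λ y≈z → ∙-congʳ (∙-congˡ y≈z))
         (λ z≉x eq → z≉x (∙-cancelˡ v _ _ (∙-cancelʳ u _ _ eq))))

  -- `_≲_` is a parameter because the relation induced on a quotient is not literally the negation
  -- of `C`, only equivalent to it. Totality is asymmetry of `C`; transitivity is `branch`
  -- contraposed.
  isOrderType : {_≲_ : Rel Carrier (ℓ ⊔ r)} →
                (∀ x y → (x ≲ y) ⇔ (¬ C x y ε)) → IsOrderType G _≲_
  isOrderType {_≲_} ≲⇔¬C = record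
    { isCQuasiOrder = record
      { isTotalPreorder = record
        { isPreorder = record
          { isEquivalence = isEquivalence
          ; reflexive     = λ x≈y → ¬C⇒≲ (λ Cxy →
              asym Cxy (resp x≈y (sym x≈y) refl Cxy))
          ; trans         = λ {_} {y} x≲y y≲z → ¬C⇒≲ (λ Cxz →
              [ ≲⇒¬C y≲z , ≲⇒¬C x≲y ] (branch y Cxz))
          }
        ; total = total-≲
        }
      ; C           = C
      ; isCRelation = isCRelation
      ; compatible  = compatible
      ; ≲⇔¬C        = ≲⇔¬C
      }
    ; _≤_          = _≤_
    ; isGroupOrder = isGroupOrder
    ; C⇔           = λ _ _ _ → mk⇔ id id
    }
    where
    open IsCRelation isCRelation using (resp; asym; branch)

    ≲⇒¬C : ∀ {x y} → x ≲ y → ¬ C x y ε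
    ≲⇒¬C = Equivalence.to (≲⇔¬C _ _)

    ¬C⇒≲ : ∀ {x y} → ¬ C x y ε → x ≲ y
    ¬C⇒≲ = Equivalence.from (≲⇔¬C _ _)

    total-≲ : ∀ x y → x ≲ y ⊎ y ≲ x
    total-≲ x y with em {C x y ε}
    ... | yes Cxy = inj₂ (¬C⇒≲ (asym Cxy))
    ... | no ¬Cxy = inj₁ (¬C⇒≲ ¬Cxy)

IsSubgroup-resp-≐ : ∀ {c ℓ p q} (G : Group c ℓ) {P : Pred (Group.Carrier G) p}
                    {Q : Pred (Group.Carrier G) q} →
                    P ≐ Q → IsSubgroup G P → IsSubgroup G Q
IsSubgroup-resp-≐ G (P⊆Q , Q⊆P) isSub = record
  { resp      = λ x≈y x∈Q → P⊆Q (resp x≈y (Q⊆P x∈Q))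
  ; ε-closed  = P⊆Q ε-closed
  ; ∙-closed  = λ x∈Q y∈Q → P⊆Q (∙-closed (Q⊆P x∈Q) (Q⊆P y∈Q))
  ; ⁻¹-closed = λ x∈Q → P⊆Q (⁻¹-closed (Q⊆P x∈Q))
  }
  where open IsSubgroup isSub

-- Inequalities in a C-quasi-ordered group.

module CQuasiOrder {c ℓ r} (G : Group c ℓ) (_≲_ : Rel (Group.Carrier G) r)
                   (isCQuasiOrder : IsCQuasiOrder G _≲_) where
  open Group G
  open GroupProperties G
  open ElementTypes G _≲_
  open IsCQuasiOrder isCQuasiOrder
  open IsTotalPreorder isTotalPreorder public
    using (total; ≲-respˡ-≈; ≲-respʳ-≈)
    renaming (refl to ≲-refl; trans to ≲-trans)
  open IsCRelation isCRelation using (asym; branch; proper)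
    renaming (swap to C-swap; resp to C-resp)

  ≲⇒¬C : ∀ {x y} → x ≲ y → ¬ C x y ε
  ≲⇒¬C = Equivalence.to (≲⇔¬C _ _)

  ¬C⇒≲ : ∀ {x y} → ¬ C x y ε → x ≲ y
  ¬C⇒≲ = Equivalence.from (≲⇔¬C _ _)

  ≴⇒≳ : ∀ {x y} → ¬ (x ≲ y) → y ≲ x
  ≴⇒≳ {x} {y} x≴y = [ (λ x≲y → contradiction x≲y x≴y) , id ] (total x y)

  ≴⇒⋩ : ∀ {x y} → ¬ (x ≲ y) → y ⋨ x
  ≴⇒⋩ x≴y = ≴⇒≳ x≴y , λ y∼x → x≴y (proj₂ y∼x)

  ⋨⇒≵ : ∀ {x y} → x ⋨ y → ¬ (y ≲ x)
  ⋨⇒≵ (x≲y , x≁y) y≲x = x≁y (x≲y , y≲x)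

  -- Asymmetry with equal first two arguments refutes `C ε ε x`, hence also `C ε x ε`.
  ε-minimum : ∀ x → ε ≲ x
  ε-minimum x = ¬C⇒≲ (λ Cεxε → asym (C-swap Cεxε) (C-swap Cεxε))

  ≲ε⇒≈ε : ExcludedMiddle ℓ → ∀ {x} → x ≲ ε → x ≈ ε
  ≲ε⇒≈ε em x≲ε = decidable-stable em (λ x≉ε → ≲⇒¬C x≲ε (proper x≉ε))

  -- Right translation by `y` carries the triple `x ∙ y ⁻¹`, `y ⁻¹`, `ε` to `x`, `ε`, `y`, and the
  -- last two entries may be swapped.
  ≲⇒//≲⁻¹ : ∀ {x y} → x ≲ y → (x ∙ y ⁻¹) ≲ (y ⁻¹)
  ≲⇒//≲⁻¹ {x} {y} x≲y = ¬C⇒≲ λ Cxy⁻¹ → ≲⇒¬C x≲y (C-swap (C-resp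
    (trans (∙-congʳ (identityˡ _)) (//-rightDividesˡ y x))
    (trans (∙-congʳ (identityˡ _)) (inverseˡ y))
    (trans (∙-congʳ (identityˡ _)) (identityˡ y))
    (compatible ε y Cxy⁻¹)))

  ≲⇒\\≲⁻¹ : ∀ {x y} → x ≲ y → (y ⁻¹ ∙ x) ≲ (y ⁻¹)
  ≲⇒\\≲⁻¹ {x} {y} x≲y = ¬C⇒≲ λ Cy⁻¹x → ≲⇒¬C x≲y (C-swap (C-resp
    (trans (identityʳ _) (\\-leftDividesˡ y x))
    (trans (identityʳ _) (inverseʳ y))
    (trans (identityʳ _) (identityʳ y))
    (compatible y ε Cy⁻¹x)))

  ≲⁻¹⇒∙≲ : ∀ {x y} → x ≲ (y ⁻¹) → (x ∙ y) ≲ y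
  ≲⁻¹⇒∙≲ {y = y} x≲y⁻¹ =
    ≲-respˡ-≈ (∙-congˡ (⁻¹-involutive y)) (≲-respʳ-≈ (⁻¹-involutive y) (≲⇒//≲⁻¹ x≲y⁻¹))

  ≲⁻¹⇒∙≲ˡ : ∀ {x y} → x ≲ (y ⁻¹) → (y ∙ x) ≲ y
  ≲⁻¹⇒∙≲ˡ {y = y} x≲y⁻¹ =
    ≲-respˡ-≈ (∙-congʳ (⁻¹-involutive y)) (≲-respʳ-≈ (⁻¹-involutive y) (≲⇒\\≲⁻¹ x≲y⁻¹))

  -- Conjugation is a two-sided translation that fixes the third entry `ε` of `C`.
  conj-mono : ∀ v {x y} → x ≲ y → (v ∙ x ∙ v ⁻¹) ≲ (v ∙ y ∙ v ⁻¹)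
  conj-mono v {x} {y} x≲y = ¬C⇒≲ λ Cvxv⁻¹ → ≲⇒¬C x≲y (C-resp
    (cancel x) (cancel y)
    (trans (∙-congʳ (identityʳ _)) (inverseˡ v))
    (compatible (v ⁻¹) v Cvxv⁻¹))
    where
    cancel : ∀ z → v ⁻¹ ∙ (v ∙ z ∙ v ⁻¹) ∙ v ≈ z
    cancel z = trans (∙-congʳ (trans (∙-congˡ (assoc v z (v ⁻¹))) (\\-leftDividesʳ v _)))
                     (//-rightDividesˡ v z)

  conj⁻¹-cancel : ∀ v {x y} → (v ∙ x ∙ v ⁻¹) ≲ (v ∙ y ∙ v ⁻¹) → x ≲ y
  conj⁻¹-cancel v vx≲vy =
    ≲-respˡ-≈ (cancel _) (≲-respʳ-≈ (cancel _) (conj-mono (v ⁻¹) vx≲vy))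
    where
    cancel : ∀ z → v ⁻¹ ∙ (v ∙ z ∙ v ⁻¹) ∙ (v ⁻¹) ⁻¹ ≈ z
    cancel z = trans (∙-cong (trans (∙-congˡ (assoc v z (v ⁻¹))) (\\-leftDividesʳ v _))
                             (⁻¹-involutive v))
                     (//-rightDividesˡ v z)

  -- If instead `y ≲ y ∙ x ⁻¹`, which is the inverse of `x ∙ y ⁻¹`, then `x ≲ x ∙ y ⁻¹ ≲ y ⁻¹`.
  -- Together with `⁻¹≳⁻¹` this makes `x ⁻¹` and `y ⁻¹` equivalent, the fact behind all later
  -- comparisons of inverses.
  ⁻¹≲⁻¹ : ∀ {x y} → x ≲ y → ¬ (x ≲ (y ⁻¹)) → (x ⁻¹) ≲ (y ⁻¹)
  ⁻¹≲⁻¹ {x} {y} x≲y x≴y⁻¹ with total y (y ∙ x ⁻¹)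
  ... | inj₂ yx⁻¹≲y = ≲-respˡ-≈ (\\-leftDividesʳ y (x ⁻¹)) (≲⇒\\≲⁻¹ yx⁻¹≲y)
  ... | inj₁ y≲yx⁻¹ = contradiction
    (≲-trans (≲-respˡ-≈ (//-rightDividesˡ y x)
                (≲⁻¹⇒∙≲ˡ (≲-respʳ-≈ (sym (⁻¹-anti-homo-// x y)) y≲yx⁻¹)))
             (≲⇒//≲⁻¹ x≲y))
    x≴y⁻¹

  ⁻¹≳⁻¹ : ∀ {x y} → x ≲ y → ¬ (x ≲ (y ⁻¹)) → (y ⁻¹) ≲ (x ⁻¹)
  ⁻¹≳⁻¹ {x} {y} x≲y x≴y⁻¹ with total x (x ∙ y ⁻¹)
  ... | inj₁ x≲xy⁻¹ = contradiction (≲-trans x≲xy⁻¹ (≲⇒//≲⁻¹ x≲y)) x≴y⁻¹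
  ... | inj₂ xy⁻¹≲x = ≲-respˡ-≈ (\\-leftDividesʳ x (y ⁻¹)) (≲⇒\\≲⁻¹ xy⁻¹≲x)

-- The submonoid `N` and its two subgroups.

module PositiveElement {c ℓ r} (G : Group c ℓ) (_≲_ : Rel (Group.Carrier G) r)
                       (isCQuasiOrder : IsCQuasiOrder G _≲_)
                       (em : ExcludedMiddle r) (g : Group.Carrier G)
                       (g-o⁺ : ElementTypes.O⁺Type G _≲_ g) where
  open Group G
  open GroupProperties G
  open ElementTypes G _≲_
  open CQuasiOrder G _≲_ isCQuasiOrder
  open IsCQuasiOrder isCQuasiOrder using (C; isCRelation; compatible)
  open IsCRelation isCRelation using (branch)
    renaming (swap to C-swap; resp to C-resp)

  N : Pred Carrier r
  N x = x ≲ (g ⁻¹)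

  N± : Pred Carrier r
  N± x = N x ⊎ N (x ⁻¹)

  g∉N : g ∉ N
  g∉N = ⋨⇒≵ g-o⁺

  N-resp : ∀ {x y} → x ≈ y → x ∈ N → y ∈ N
  N-resp = ≲-respˡ-≈

  -- If `h ≲ k ⁻¹`, then `h ∙ k ≲ k`. Otherwise a product outside `N` gives `C (h ∙ k) (g ⁻¹) ε`;
  -- branching at `k` contradicts `k ∈ N` or, after translation by `k ⁻¹`, contradicts
  -- `h ≲ g ⁻¹ ∙ k ⁻¹`.
  N-∙-closed : ∀ {h k} → h ∈ N → k ∈ N → (h ∙ k) ∈ N
  N-∙-closed {h} {k} h∈N k∈N with total h (k ⁻¹)
  ... | inj₁ h≲k⁻¹ = ≲-trans (≲⁻¹⇒∙≲ h≲k⁻¹) k∈N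
  ... | inj₂ k⁻¹≲h = ¬C⇒≲ λ Chk →
    [ (λ Ck → ≲⇒¬C k∈N (C-swap Ck)) , (λ Chkk → ¬Chkg⁻¹k (C-swap Chkk)) ]
      (branch k (C-swap Chk))
    where
    -- Otherwise `g ≲ k ⁻¹ ≲ h ≲ g ⁻¹`.
    k≲kg : k ≲ (k ∙ g)
    k≲kg = ≴⇒≳ λ kg≲k → g∉N (≲-trans
      (≲-trans (≲-respˡ-≈ (\\-leftDividesʳ k g) (≲⇒\\≲⁻¹ kg≲k)) k⁻¹≲h) h∈N)

    -- Left division of `k ≲ k ∙ g` by `k ∙ g` gives `g ⁻¹ ≲ g ⁻¹ ∙ k ⁻¹`.
    h≲g⁻¹k⁻¹ : h ≲ (g ⁻¹ ∙ k ⁻¹)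
    h≲g⁻¹k⁻¹ = ≲-trans h∈N (≲-respʳ-≈ (⁻¹-anti-homo-∙ k g) (≲-respˡ-≈
      (trans (∙-congʳ (⁻¹-anti-homo-∙ k g)) (//-rightDividesˡ k (g ⁻¹)))
      (≲⇒\\≲⁻¹ k≲kg)))

    ¬Chkg⁻¹k : ¬ C (h ∙ k) (g ⁻¹) k
    ¬Chkg⁻¹k Chk = ≲⇒¬C h≲g⁻¹k⁻¹ (C-resp
      (trans (∙-congʳ (identityˡ _)) (//-rightDividesʳ k h))
      (∙-congʳ (identityˡ _))
      (trans (∙-congʳ (identityˡ _)) (inverseʳ k))
      (compatible ε (k ⁻¹) Chk))

  ε∈N : ε ∈ N
  ε∈N = ε-minimum _

  -- Comparing the inverses decides the side: `b ⁻¹ ≲ a ⁻¹` yields `a ∙ b ⁻¹ ≲ a`. This covers the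
  -- mixed products in `N±`.
  //∈N± : ∀ {a b} → a ∈ N → b ∈ N → (a ∙ b ⁻¹) ∈ N ⊎ (b ∙ a ⁻¹) ∈ N
  //∈N± {a} {b} a∈N b∈N = ⊎-map
    (λ b⁻¹≲a⁻¹ → ≲-trans (≲⁻¹⇒∙≲ˡ b⁻¹≲a⁻¹) a∈N)
    (λ a⁻¹≲b⁻¹ → ≲-trans (≲⁻¹⇒∙≲ˡ a⁻¹≲b⁻¹) b∈N)
    (total (b ⁻¹) (a ⁻¹))

  \\∈N± : ∀ {a b} → a ∈ N → b ∈ N → (a ⁻¹ ∙ b) ∈ N ⊎ (b ⁻¹ ∙ a) ∈ N
  \\∈N± {a} {b} a∈N b∈N = ⊎-map
    (λ a⁻¹≲b⁻¹ → ≲-trans (≲⁻¹⇒∙≲ a⁻¹≲b⁻¹) b∈N)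
    (λ b⁻¹≲a⁻¹ → ≲-trans (≲⁻¹⇒∙≲ b⁻¹≲a⁻¹) a∈N)
    (total (a ⁻¹) (b ⁻¹))

  N±-isSubgroup : IsSubgroup G N±
  N±-isSubgroup = record
    { resp      = λ x≈y → ⊎-map (N-resp x≈y) (N-resp (⁻¹-cong x≈y))
    ; ε-closed  = inj₁ ε∈N
    ; ∙-closed  = ∙-closed
    ; ⁻¹-closed = λ {x} → ⊎-swap ∘ ⊎-map (N-resp (sym (⁻¹-involutive x))) id
    }
    where
    ∙-closed : ∀ {x y} → x ∈ N± → y ∈ N± → (x ∙ y) ∈ N±
    ∙-closed (inj₁ x∈N) (inj₁ y∈N) = inj₁ (N-∙-closed x∈N y∈N)
    ∙-closed {x} {y} (inj₂ x⁻¹∈N) (inj₂ y⁻¹∈N) =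
      inj₂ (N-resp (sym (⁻¹-anti-homo-∙ x y)) (N-∙-closed y⁻¹∈N x⁻¹∈N))
    ∙-closed {x} {y} (inj₁ x∈N) (inj₂ y⁻¹∈N) = ⊎-map
      (N-resp (∙-congˡ (⁻¹-involutive y)))
      (N-resp (sym (⁻¹-anti-homo-∙ x y)))
      (//∈N± x∈N y⁻¹∈N)
    ∙-closed {x} {y} (inj₂ x⁻¹∈N) (inj₁ y∈N) = ⊎-map
      (N-resp (∙-congʳ (⁻¹-involutive x)))
      (N-resp (sym (⁻¹-anti-homo-∙ x y)))
      (\\∈N± x⁻¹∈N y∈N)

  open IsSubgroup N±-isSubgroup using ()
    renaming (∙-closed to N±-∙-closed; ⁻¹-closed to N±-⁻¹-closed)

  ⁻¹-anti-homo-conj : ∀ x y → (x ∙ y ∙ x ⁻¹) ⁻¹ ≈ x ∙ y ⁻¹ ∙ x ⁻¹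
  ⁻¹-anti-homo-conj x y = trans (⁻¹-anti-homo-// (x ∙ y) x)
    (trans (∙-congˡ (⁻¹-anti-homo-∙ x y)) (sym (assoc x (y ⁻¹) (x ⁻¹))))

  -- By monotonicity of conjugation it suffices to treat `g ⁻¹`, whose conjugate lies in the
  -- subgroup `N±`.
  N-conj-closed : ∀ {x y} → x ∈ N± → y ∈ N → (x ∙ y ∙ x ⁻¹) ∈ N
  N-conj-closed {x} {y} x∈N± y∈N = ≲-trans (conj-mono x y∈N) (conj-g⁻¹
    (N±-∙-closed (N±-∙-closed x∈N± (inj₁ ≲-refl)) (N±-⁻¹-closed x∈N±)))
    where
    conj-g⁻¹ : (x ∙ g ⁻¹ ∙ x ⁻¹) ∈ N± → (x ∙ g ⁻¹ ∙ x ⁻¹) ∈ N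
    conj-g⁻¹ (inj₁ xg⁻¹x⁻¹∈N) = xg⁻¹x⁻¹∈N
    -- Were `g ⁻¹` below its conjugate, then `x ∙ g ∙ x ⁻¹ ≲ x ∙ g ⁻¹ ∙ x ⁻¹`, and undoing the
    -- conjugation gives `g ≲ g ⁻¹`.
    conj-g⁻¹ (inj₂ xgx⁻¹∈N) = [ id , (λ g⁻¹≲xg⁻¹x⁻¹ → contradiction
      (conj⁻¹-cancel x (≲-trans (N-resp eq xgx⁻¹∈N) g⁻¹≲xg⁻¹x⁻¹)) g∉N) ]
      (total (x ∙ g ⁻¹ ∙ x ⁻¹) (g ⁻¹))
      where
      eq : (x ∙ g ⁻¹ ∙ x ⁻¹) ⁻¹ ≈ x ∙ g ∙ x ⁻¹
      eq = trans (⁻¹-anti-homo-conj x (g ⁻¹)) (∙-congʳ (∙-congˡ (⁻¹-involutive g)))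

  -- The smaller of `x ⁻¹` and `g` is not below the inverse of the larger, so `x` and `g ⁻¹` are
  -- equivalent. All of `N` outside `G₊ g` thus lies in one class, at the top of `N`.
  ∈N∧⁻¹∉N⇒≳ : ∀ {x} → x ∈ N → (x ⁻¹) ∉ N → (g ⁻¹) ≲ x
  ∈N∧⁻¹∉N⇒≳ {x} x∈N x⁻¹∉N with total (x ⁻¹) g
  ... | inj₁ x⁻¹≲g = ≲-respʳ-≈ (⁻¹-involutive x) (⁻¹≳⁻¹ x⁻¹≲g x⁻¹∉N)
  ... | inj₂ g≲x⁻¹ = ≲-respʳ-≈ (⁻¹-involutive x) (⁻¹≲⁻¹ g≲x⁻¹
    λ g≲x⁻¹⁻¹ → g∉N (≲-trans (≲-respʳ-≈ (⁻¹-involutive x) g≲x⁻¹⁻¹) x∈N))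

  G₊-isSubgroup : IsSubgroup G (G₊ g)
  G₊-isSubgroup = record
    { resp      = λ x≈y → map (N-resp x≈y) (N-resp (⁻¹-cong x≈y))
    ; ε-closed  = ε∈N , N-resp (sym ε⁻¹≈ε) ε∈N
    ; ∙-closed  = λ {x} {y} (x∈N , x⁻¹∈N) (y∈N , y⁻¹∈N) →
        N-∙-closed x∈N y∈N , N-resp (sym (⁻¹-anti-homo-∙ x y)) (N-∙-closed y⁻¹∈N x⁻¹∈N)
    ; ⁻¹-closed = λ {x} (x∈N , x⁻¹∈N) → x⁻¹∈N , N-resp (sym (⁻¹-involutive x)) x∈N
    }

  N±-convex : Convex N±
  N±-convex _ (inj₁ t∈N) _ x≲t = inj₁ (≲-trans x≲t t∈N)
  N±-convex {x = x} _ (inj₂ t⁻¹∈N) _ x≲t with em {N x}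
  ... | yes x∈N = inj₁ x∈N
  ... | no  x∉N = inj₂ (≲-trans (⁻¹≲⁻¹ x≲t λ x≲t⁻¹ → x∉N (≲-trans x≲t⁻¹ t⁻¹∈N)) t⁻¹∈N)

  -- The set `T⁺ g` in terms of `N`.

  O⁺⇒¬O⁺⁻¹ : ∀ {x} → O⁺Type x → ¬ O⁺Type (x ⁻¹)
  O⁺⇒¬O⁺⁻¹ {x} x-o⁺ (x⁻¹⁻¹≲x⁻¹ , _) =
    ⋨⇒≵ x-o⁺ (≲-respˡ-≈ (⁻¹-involutive x) x⁻¹⁻¹≲x⁻¹)

  -- The test element is `g ⁻¹` if `h ≲ g`, and `h ⁻¹` if `g ≲ h`. It is not of o⁺-type, so it
  -- cannot lie between `g` and `h`.
  T⁺⇒ : ∀ {h} → h ∈ T⁺ g → (h ⁻¹) ∈ N × h ∉ N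
  T⁺⇒ {h} (h-o⁺ , between-o⁺) with total h g
  ... | inj₁ h≲g = ⁻¹≲⁻¹ h≲g h∉N , h∉N
    where
    h∉N : h ∉ N
    h∉N h≲g⁻¹ = O⁺⇒¬O⁺⁻¹ g-o⁺ (between-o⁺ (g ⁻¹) (inj₂ (h≲g⁻¹ , proj₁ g-o⁺)))
  ... | inj₂ g≲h = ⁻¹≳⁻¹ g≲h g≴h⁻¹ , λ h∈N → g∉N (≲-trans g≲h h∈N)
    where
    g≴h⁻¹ : ¬ (g ≲ (h ⁻¹))
    g≴h⁻¹ g≲h⁻¹ = O⁺⇒¬O⁺⁻¹ h-o⁺ (between-o⁺ (h ⁻¹) (inj₁ (g≲h⁻¹ , proj₁ h-o⁺)))

  ≲∧≴⁻¹⇒O⁺ : ∀ {x y} → x ≲ y → ¬ (x ≲ (y ⁻¹)) → O⁺Type x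
  ≲∧≴⁻¹⇒O⁺ x≲y x≴y⁻¹ =
    ≴⇒⋩ λ x≲x⁻¹ → x≴y⁻¹ (≲-trans x≲x⁻¹ (⁻¹≲⁻¹ x≲y x≴y⁻¹))

  -- `≲∧≴⁻¹⇒O⁺` applies with `y` the upper of `g` and `h`: its inverse lies in `N`, while the lower
  -- one does not.
  ⇒T⁺ : ∀ {h} → (h ⁻¹) ∈ N → h ∉ N → h ∈ T⁺ g
  ⇒T⁺ {h} h⁻¹∈N h∉N =
    ≴⇒⋩ (λ h≲h⁻¹ → h∉N (≲-trans h≲h⁻¹ h⁻¹∈N)) , λ where
      x (inj₁ (g≲x , x≲h)) → ≲∧≴⁻¹⇒O⁺ x≲h
        λ x≲h⁻¹ → g∉N (≲-trans g≲x (≲-trans x≲h⁻¹ h⁻¹∈N))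
      x (inj₂ (h≲x , x≲g)) → ≲∧≴⁻¹⇒O⁺ x≲g λ x∈N → h∉N (≲-trans h≲x x∈N)

  G₊∪T₊≐N± : (λ h → G₊ g h ⊎ T₊ g h) ≐ N±
  G₊∪T₊≐N± = to , from
    where
    to : ∀ {h} → G₊ g h ⊎ T₊ g h → N± h
    to (inj₁ (h∈N , _))                  = inj₁ h∈N
    to (inj₂ (inj₁ h∈T⁺))                = inj₂ (proj₁ (T⁺⇒ h∈T⁺))
    to (inj₂ (inj₂ (k , k∈T⁺ , h≈k⁻¹))) = inj₁ (N-resp (sym h≈k⁻¹) (proj₁ (T⁺⇒ k∈T⁺)))

    from : ∀ {h} → N± h → G₊ g h ⊎ T₊ g h
    from {h} (inj₁ h∈N) with em {N (h ⁻¹)}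
    ... | yes h⁻¹∈N = inj₁ (h∈N , h⁻¹∈N)
    ... | no  h⁻¹∉N = inj₂ (inj₂ (h ⁻¹ ,
      ⇒T⁺ (N-resp (sym (⁻¹-involutive h)) h∈N) h⁻¹∉N , sym (⁻¹-involutive h)))
    from {h} (inj₂ h⁻¹∈N) with em {N h}
    ... | yes h∈N = inj₁ (h∈N , h⁻¹∈N)
    ... | no  h∉N = inj₂ (inj₁ (⇒T⁺ h⁻¹∈N h∉N))

  ≲⇒\\∈N : ∀ {x y} → y ∈ N± → y ∉ N → x ≲ y → (y ⁻¹ ∙ x) ∈ N
  ≲⇒\\∈N y∈N± y∉N x≲y =
    ≲-trans (≲⇒\\≲⁻¹ x≲y) ([ (λ y∈N → contradiction y∈N y∉N) , id ] y∈N±)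

  \\∈N⇒≲ : ∀ {x y} → y ∈ N± → y ∉ N → (y ⁻¹ ∙ x) ∈ N → x ≲ y
  \\∈N⇒≲ (inj₁ y∈N) y∉N _ = contradiction y∈N y∉N
  \\∈N⇒≲ {x} {y} (inj₂ y⁻¹∈N) y∉N y⁻¹x∈N =
    -- `y ⁻¹` is at the top of `N`, so `y ⁻¹ ∙ x ≲ g ⁻¹ ≲ y ⁻¹`; it remains to multiply by `y`.
    ≲-respˡ-≈ (\\-leftDividesˡ y x) (≲⁻¹⇒∙≲ˡ (≲-trans y⁻¹x∈N
      (∈N∧⁻¹∉N⇒≳ y⁻¹∈N λ y⁻¹⁻¹∈N → y∉N (N-resp (⁻¹-involutive y) y⁻¹⁻¹∈N))))

  -- The order on the quotient Gᵍ / G_g.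

  -- U and V are Gᵍ and G_g; they are kept abstract because the definitions of
  -- G↑ and G↓ also split on the type of the element.
  module Quotient {u} {U : Pred Carrier u} {V : Pred Carrier r}
                  (U≐N± : U ≐ N±) (V≐G₊ : V ≐ G₊ g) where

    U-isSubgroup : IsSubgroup G U
    U-isSubgroup = IsSubgroup-resp-≐ G (swap U≐N±) N±-isSubgroup

    V-isSubgroup : IsSubgroup G V
    V-isSubgroup = IsSubgroup-resp-≐ G (swap V≐G₊) G₊-isSubgroup

    U-convex : Convex U
    U-convex s∈U t∈U s≲x x≲t =
      proj₂ U≐N± (N±-convex (proj₁ U≐N± s∈U) (proj₁ U≐N± t∈U) s≲x x≲t)

    K : Group (c ⊔ u) ℓ
    K = subgroup G U-isSubgroup

    module K = Group K

    _≲K_ : Rel K.Carrier r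
    _≲K_ = _≲_ on proj₁

    VK : Pred K.Carrier r
    VK x = proj₁ x ∈ V

    ∈N± : (x : K.Carrier) → proj₁ x ∈ N±
    ∈N± (_ , x∈U) = proj₁ U≐N± x∈U

    ∈V : ∀ {x} → x ∈ N → (x ⁻¹) ∈ N → x ∈ V
    ∈V x∈N x⁻¹∈N = proj₂ V≐G₊ (x∈N , x⁻¹∈N)

    VK-isNormalSubgroup : IsNormalSubgroup K VK
    VK-isNormalSubgroup = record
      { isSubgroup = record
        { resp      = resp
        ; ε-closed  = ε-closed
        ; ∙-closed  = ∙-closed
        ; ⁻¹-closed = ⁻¹-closed
        }
      ; conj-closed = λ {h} x h∈V → ∈V
          (N-conj-closed (∈N± x) (proj₁ (proj₁ V≐G₊ h∈V)))
          (N-resp (sym (⁻¹-anti-homo-conj (proj₁ x) (proj₁ h)))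
            (N-conj-closed (∈N± x) (proj₂ (proj₁ V≐G₊ h∈V))))
      }
      where open IsSubgroup V-isSubgroup

    -- An `x` in `N` with `x ⁻¹` outside `N` would be at the top of `N`, hence not strictly below
    -- `t`.
    VK-strictlyConvex : QuasiOrder.StrictlyConvex _≲K_ VK
    VK-strictlyConvex {x = x} _ t∈V _ x⋨t = ∈V x∈N (decidable-stable em λ x⁻¹∉N →
      ⋨⇒≵ x⋨t (≲-trans t∈N (∈N∧⁻¹∉N⇒≳ x∈N x⁻¹∉N)))
      where
      t∈N = proj₁ (proj₁ V≐G₊ t∈V)
      x∈N = ≲-trans (proj₁ x⋨t) t∈N

    Q : Group (c ⊔ u) r
    Q = quotient K VK-isNormalSubgroup

    _≤_ : Rel K.Carrier r
    x ≤ y = proj₁ (y K.⁻¹ K.∙ x) ∈ N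

    -- Reflexivity and antisymmetry come from `V` being `N` ∩ `N`⁻¹, transitivity from products,
    -- totality from `U` being `N` ∪ `N`⁻¹, and right monotonicity from invariance under
    -- conjugation.
    ≤-isGroupOrder : IsGroupOrder Q _≤_
    ≤-isGroupOrder = record
      { isTotalOrder = record
        { isPartialOrder = record
          { isPreorder = record
            { isEquivalence = Group.isEquivalence Q
            ; reflexive     = λ {(x , _)} {(y , _)} x⁻¹y∈V →
                N-resp (⁻¹-anti-homo-\\ x y) (proj₂ (proj₁ V≐G₊ x⁻¹y∈V))
            ; trans         = λ {(x , _)} {(y , _)} {(z , _)} y⁻¹x∈N z⁻¹y∈N →
                N-resp (trans (assoc _ _ _) (∙-congˡ (\\-leftDividesˡ y x)))
                       (N-∙-closed z⁻¹y∈N y⁻¹x∈N)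
            }
          ; antisym = λ {(x , _)} {(y , _)} y⁻¹x∈N x⁻¹y∈N →
              ∈V x⁻¹y∈N (N-resp (sym (⁻¹-anti-homo-\\ x y)) y⁻¹x∈N)
          }
        ; total = λ x y → ⊎-map
            id (N-resp (⁻¹-anti-homo-\\ (proj₁ y) (proj₁ x)))
            (∈N± (y K.⁻¹ K.∙ x))
        }
      ; ∙-monoʳ = λ {(x , _)} {(y , _)} z y⁻¹x∈N →
          N-resp (conj-eq x y (proj₁ z)) (N-conj-closed (∈N± (z K.⁻¹)) y⁻¹x∈N)
      ; ∙-monoˡ = λ {(x , _)} {(y , _)} z y⁻¹x∈N →
          N-resp (sym (cancel x y (proj₁ z))) y⁻¹x∈N
      }
      where
      conj-eq : ∀ x y z → z ⁻¹ ∙ (y ⁻¹ ∙ x) ∙ (z ⁻¹) ⁻¹ ≈ (y ∙ z) ⁻¹ ∙ (x ∙ z)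
      conj-eq x y z = trans (∙-cong (sym (assoc _ _ _)) (⁻¹-involutive z))
        (trans (assoc _ _ _) (∙-congʳ (sym (⁻¹-anti-homo-∙ y z))))

      cancel : ∀ x y z → (z ∙ y) ⁻¹ ∙ (z ∙ x) ≈ y ⁻¹ ∙ x
      cancel x y z = trans (∙-congʳ (⁻¹-anti-homo-∙ z y))
        (trans (assoc _ _ _) (∙-congˡ (\\-leftDividesʳ z x)))

    -- Equality in `Q` is membership in `V`, at level `r`, so the level of the order collapses to
    -- `r`.
    open OrderedGroup {r = r} em Q ≤-isGroupOrder using (_<_; ≮⇒≥; isOrderType)
      renaming (C to CQ)

    ≤ε⇒∈N : ∀ x → x ≤ K.ε → proj₁ x ∈ N
    ≤ε⇒∈N _ = N-resp (trans (∙-congʳ ε⁻¹≈ε) (identityˡ _))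

    ∈N⇒≤ε : ∀ x → proj₁ x ∈ N → x ≤ K.ε
    ∈N⇒≤ε _ = N-resp (sym (trans (∙-congʳ ε⁻¹≈ε) (identityˡ _)))

    _≲Q_ : Rel K.Carrier r
    _≲Q_ = inducedOnQuotient K _≲K_ VK

    module V = IsSubgroup V-isSubgroup
    module Q = Group Q
    open IsTotalOrder (IsGroupOrder.isTotalOrder ≤-isGroupOrder) using ()
      renaming (antisym to ≤-antisym)

    ≈ε⇒∈V : ∀ x → x Q.≈ K.ε → proj₁ x ∈ V
    ≈ε⇒∈V (x , _) x⁻¹ε∈V =
      V.resp (trans (⁻¹-cong (identityʳ _)) (⁻¹-involutive x)) (V.⁻¹-closed x⁻¹ε∈V)

    ∈V⇒≈ε : ∀ x → proj₁ x ∈ V → x Q.≈ K.ε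
    ∈V⇒≈ε _ x∈V = V.resp (sym (identityʳ _)) (V.⁻¹-closed x∈V)

    ≲Q⇒¬CQ : ∀ x y → x ≲Q y → ¬ CQ x y K.ε
    ≲Q⇒¬CQ x y (inj₁ x∈V) (inj₁ (_ , _ , ε≉x)) = ε≉x (Q.sym {x} {K.ε} (∈V⇒≈ε x x∈V))
    ≲Q⇒¬CQ x y (inj₁ x∈V) (inj₂ (_ , ε≉x))     = ε≉x (Q.sym {x} {K.ε} (∈V⇒≈ε x x∈V))
    ≲Q⇒¬CQ x y (inj₂ (y∉V , _)) (inj₂ (y≈ε , _)) = y∉V (≈ε⇒∈V y y≈ε)
    -- If `y ∈ N`, then `x ∈ N`, against `ε < x`. If not, `x ≲ y` already gives `x ≤ y`.
    ≲Q⇒¬CQ x y (inj₂ (_ , x≲y)) (inj₁ ((y≤x , y≉x) , (ε≤x , ε≉x)))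
      with em {proj₁ y ∈ N}
    ... | yes y∈N = ε≉x (≤-antisym {K.ε} {x} ε≤x (∈N⇒≤ε x (≲-trans x≲y y∈N)))
    ... | no  y∉N = y≉x (≤-antisym {y} {x} y≤x (≲⇒\\∈N (∈N± y) y∉N x≲y))

    ¬CQ⇒≲Q : ∀ x y → ¬ CQ x y K.ε → x ≲Q y
    ¬CQ⇒≲Q x y ¬CQxy with em {proj₁ x ∈ V} | em {proj₁ y ∈ V}
    ... | yes x∈V | _       = inj₁ x∈V
    ... | no  x∉V | yes y∈V = contradiction
      (inj₂ (∈V⇒≈ε y y∈V , λ ε≈x → x∉V (≈ε⇒∈V x (Q.sym {K.ε} {x} ε≈x)))) ¬CQxy
    ... | no  x∉V | no  y∉V = inj₂ (y∉V , x≲y)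
      where
      -- The first alternative of `CQ` fails, so `x` is not strictly above both `y` and `ε`.
      x≤y∨x≤ε : x ≤ y ⊎ x ≤ K.ε
      x≤y∨x≤ε with em {y < x}
      ... | no  y≮x = inj₁ (≮⇒≥ {y} {x} y≮x)
      ... | yes y<x = inj₂ (≮⇒≥ {K.ε} {x} λ ε<x → ¬CQxy (inj₁ (y<x , ε<x)))

      x≲y : proj₁ x ≲ proj₁ y
      x≲y with em {proj₁ y ∈ N}
      ... | no  y∉N = [ \\∈N⇒≲ (∈N± y) y∉N
                      , (λ x≤ε → ≲-trans (≤ε⇒∈N x x≤ε) (≴⇒≳ y∉N)) ] x≤y∨x≤ε
      -- Both alternatives put `x` in `N`, as `x` is `y ∙ (y ⁻¹ ∙ x)`; and `y`, being in `N` but not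
      -- in `V`, is at the top of `N`.
      ... | yes y∈N = ≲-trans
        ([ (λ x≤y → N-resp (\\-leftDividesˡ _ _) (N-∙-closed y∈N x≤y))
         , ≤ε⇒∈N x ] x≤y∨x≤ε)
        (∈N∧⁻¹∉N⇒≳ y∈N λ y⁻¹∈N → y∉V (∈V y∈N y⁻¹∈N))

    hasOrderTypeQuotient : HasOrderTypeQuotient K _≲K_ VK
    hasOrderTypeQuotient = record
      { isNormalSubgroup = VK-isNormalSubgroup
      ; strictlyConvex   = λ {s} {t} {x} → VK-strictlyConvex {s} {t} {x}
      ; isOrderType      = isOrderType {_≲_ = _≲Q_} λ x y → mk⇔ (≲Q⇒¬CQ x y) (¬CQ⇒≲Q x y)
      }

    -- Minimality of G_g.

    module Smallest {p} (em-ℓ : ExcludedMiddle ℓ) (em-p : ExcludedMiddle p)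
                    {M : Pred K.Carrier p}
                    (M-hasOrderTypeQuotient : HasOrderTypeQuotient K _≲K_ M) where
      open HasOrderTypeQuotient M-hasOrderTypeQuotient
        renaming (isNormalSubgroup to M-isNormalSubgroup; isOrderType to M-isOrderType)
      module M = IsNormalSubgroup M-isNormalSubgroup
      module R = Group (quotient K M-isNormalSubgroup)
      open IsOrderType M-isOrderType
        renaming (_≤_ to _≤ᴹ_; C to Cᴹ; ≲⇔¬C to ≲ᴹ⇔¬C)
      open IsGroupOrder isGroupOrder
      open IsTotalOrder isTotalOrder
        using (antisym; ≤-respˡ-≈; ≤-respʳ-≈)
        renaming (total to ≤ᴹ-total; trans to ≤ᴹ-trans)

      g∈U : g ∈ U
      g∈U = proj₂ U≐N± (inj₂ ≲-refl)

      gᴷ : K.Carrier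
      gᴷ = g , g∈U

      ≈ε⇒∈M : ∀ {x} → x R.≈ K.ε → x ∈ M
      ≈ε⇒∈M {x} x⁻¹ε∈M =
        M.resp (trans (⁻¹-cong (identityʳ _)) (⁻¹-involutive (proj₁ x)))
               (M.⁻¹-closed x⁻¹ε∈M)

      -- An `h` outside `M` would satisfy `ε ⋨ h ⋨ g`: only `ε` is below `ε`, and `g ∉ N`.
      g∈M⇒∈M : gᴷ ∈ M → VK ⊆ M
      g∈M⇒∈M g∈M {h} h∈V = decidable-stable em-p λ h∉M →
        h∉M (strictlyConvex M.ε-closed g∈M
          (≴⇒⋩ λ h≲ε → h∉M (M.resp (sym (≲ε⇒≈ε em-ℓ h≲ε)) M.ε-closed))
          (≴⇒⋩ λ g≲h → g∉N (≲-trans g≲h (proj₁ (proj₁ V≐G₊ h∈V)))))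

      g⁻¹∉M : gᴷ ∉ M → (gᴷ K.⁻¹) ∉ M
      g⁻¹∉M g∉M g⁻¹∈M = g∉M (M.resp (⁻¹-involutive g) (M.⁻¹-closed g⁻¹∈M))

      -- Otherwise `g` is nonpositive and `Cᴹ g (g ⁻¹) ε` fails, so `g` is below `g ⁻¹` in the
      -- quotient. As `g ∉ M`, this means `g ≲ g ⁻¹`.
      g⁻¹≤ᴹε : gᴷ ∉ M → (gᴷ K.⁻¹) ≤ᴹ K.ε
      g⁻¹≤ᴹε g∉M with ≤ᴹ-total (gᴷ K.⁻¹) K.ε
      ... | inj₁ g⁻¹≤ε = g⁻¹≤ε
      ... | inj₂ ε≤g⁻¹ = contradiction
        ([ (λ g∈M → contradiction g∈M g∉M) , proj₂ ]
          (Equivalence.from (≲ᴹ⇔¬C gᴷ (gᴷ K.⁻¹)) ¬Cgg⁻¹ε)) g∉N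
        where
        g≤ε : gᴷ ≤ᴹ K.ε
        g≤ε = ≤-respˡ-≈ (R.identityʳ gᴷ)
          (≤-respʳ-≈ (R.inverseʳ gᴷ) (∙-monoˡ gᴷ ε≤g⁻¹))

        ¬Cgg⁻¹ε : ¬ Cᴹ gᴷ (gᴷ K.⁻¹) K.ε
        ¬Cgg⁻¹ε Cgg⁻¹ε with Equivalence.to (C⇔ _ _ _) Cgg⁻¹ε
        ... | inj₁ (_ , ε≤g , ε≉g) = ε≉g (antisym ε≤g g≤ε)
        ... | inj₂ (g⁻¹≈ε , _)     = g⁻¹∉M g∉M (≈ε⇒∈M g⁻¹≈ε)

      -- Outside `M`, `h` would be strictly above `ε` and `g ⁻¹`, whence `Cᴹ h (g ⁻¹) ε`; but
      -- `h ≲ g ⁻¹` persists in the quotient because `g ⁻¹ ∉ M`.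
      ≥ᴹε⇒∈M : gᴷ ∉ M → ∀ {h} → h ∈ VK → K.ε ≤ᴹ h → h ∈ M
      ≥ᴹε⇒∈M g∉M {h} h∈V ε≤h = decidable-stable em-p λ h∉M →
        Equivalence.to (≲ᴹ⇔¬C h (gᴷ K.⁻¹))
          (inj₂ (g⁻¹∉M g∉M , proj₁ (proj₁ V≐G₊ h∈V)))
          (Equivalence.from (C⇔ _ _ _) (inj₁
            ( (≤ᴹ-trans (g⁻¹≤ᴹε g∉M) ε≤h , λ g⁻¹≈h →
                h∉M (≈ε⇒∈M (antisym (≤-respˡ-≈ g⁻¹≈h (g⁻¹≤ᴹε g∉M)) ε≤h)))
            , (ε≤h , λ ε≈h → h∉M (≈ε⇒∈M (R.sym ε≈h))))))

      V⊆M : VK ⊆ M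
      V⊆M {h} h∈V with em-p {gᴷ ∈ M} | ≤ᴹ-total K.ε h
      ... | yes g∈M | _        = g∈M⇒∈M g∈M h∈V
      ... | no  g∉M | inj₁ ε≤h = ≥ᴹε⇒∈M g∉M h∈V ε≤h
      -- Here `h ⁻¹` is nonnegative, and `V` and `M` are closed under inverses.
      ... | no  g∉M | inj₂ h≤ε = M.resp (⁻¹-involutive (proj₁ h)) (M.⁻¹-closed
        (≥ᴹε⇒∈M g∉M (V.⁻¹-closed h∈V)
          (≤-respʳ-≈ (R.identityʳ (h K.⁻¹))
            (≤-respˡ-≈ (R.inverseˡ h) (∙-monoˡ (h K.⁻¹) h≤ε)))))

-- Reduction to elements of o⁺-type.

module Sign {c ℓ r} (em : ExcludedMiddle r) (G : Group c ℓ)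
            (_≲_ : Rel (Group.Carrier G) r)
            (isCQuasiOrder : IsCQuasiOrder G _≲_) where
  open Group G
  open GroupProperties G
  open ElementTypes G _≲_
  open CQuasiOrder G _≲_ isCQuasiOrder

  -- Absorbs the split on the sign of `g` in `G↓` and `G↑`; `k` will be `g` or `g ⁻¹`.
  record PositiveRepresentative (g : Carrier) : Set (c ⊔ ℓ ⊔ r) where
    field
      k    : Carrier
      k-o⁺ : O⁺Type k
      G↓≐  : G↓ g ≐ G₊ k
      G↑≐  : G↑ g ≐ PositiveElement.N± G _≲_ isCQuasiOrder em k k-o⁺

  positiveRepresentative : ∀ {g} → ¬ (g ≈ ε) → OType g → PositiveRepresentative g
  positiveRepresentative g≉ε (inj₁ g≈ε) = contradiction g≈ε g≉ε
  positiveRepresentative {g} _ (inj₂ g≁g⁻¹) with total g (g ⁻¹)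
  ... | inj₂ g⁻¹≲g = record
    { k    = g
    ; k-o⁺ = g-o⁺
    ; G↓≐  = G↓⇒G₊ , G₊⇒G↓
    ; G↑≐  = proj₁ G₊∪T₊≐N± ∘ ⊎-map G↓⇒G₊ T⇒T₊
           , ⊎-map G₊⇒G↓ (λ h∈T₊ → inj₁ (g-o⁺ , h∈T₊)) ∘ proj₂ G₊∪T₊≐N±
    }
    where
    g-o⁺ : O⁺Type g
    g-o⁺ = g⁻¹≲g , g≁g⁻¹ ∘ swap

    open PositiveElement G _≲_ isCQuasiOrder em g g-o⁺ using (G₊∪T₊≐N±)

    G↓⇒G₊ : G↓ g ⊆ G₊ g
    G↓⇒G₊ (inj₁ (_ , h∈G₊)) = h∈G₊
    G↓⇒G₊ (inj₂ (g-o⁻ , _)) = contradiction g⁻¹≲g (⋨⇒≵ g-o⁻)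

    G₊⇒G↓ : G₊ g ⊆ G↓ g
    G₊⇒G↓ h∈G₊ = inj₁ (g-o⁺ , h∈G₊)

    T⇒T₊ : T g ⊆ T₊ g
    T⇒T₊ (inj₁ (_ , h∈T₊)) = h∈T₊
    T⇒T₊ (inj₂ (g-o⁻ , _)) = contradiction g⁻¹≲g (⋨⇒≵ g-o⁻)
  ... | inj₁ g≲g⁻¹ = record
    { k    = g ⁻¹
    ; k-o⁺ = g⁻¹-o⁺
    ; G↓≐  = G↓⇒G₊ , G₊⇒G↓
    ; G↑≐  = proj₁ G₊∪T₊≐N± ∘ ⊎-map G↓⇒G₊ T⇒T₊
           , ⊎-map G₊⇒G↓ (λ h∈T₊ → inj₂ (g-o⁻ , h∈T₊)) ∘ proj₂ G₊∪T₊≐N±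
    }
    where
    g-o⁻ : O⁻Type g
    g-o⁻ = g≲g⁻¹ , g≁g⁻¹

    g⁻¹-o⁺ : O⁺Type (g ⁻¹)
    g⁻¹-o⁺ = ≴⇒⋩ λ g⁻¹≲g⁻¹⁻¹ → ⋨⇒≵ g-o⁻ (≲-respʳ-≈ (⁻¹-involutive g) g⁻¹≲g⁻¹⁻¹)

    open PositiveElement G _≲_ isCQuasiOrder em (g ⁻¹) g⁻¹-o⁺ using (G₊∪T₊≐N±)

    G↓⇒G₊ : G↓ g ⊆ G₊ (g ⁻¹)
    G↓⇒G₊ (inj₂ (_ , h∈G₊)) = h∈G₊
    G↓⇒G₊ (inj₁ (g-o⁺ , _)) = contradiction g≲g⁻¹ (⋨⇒≵ g-o⁺)

    G₊⇒G↓ : G₊ (g ⁻¹) ⊆ G↓ g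
    G₊⇒G↓ h∈G₊ = inj₂ (g-o⁻ , h∈G₊)

    T⇒T₊ : T g ⊆ T₊ (g ⁻¹)
    T⇒T₊ (inj₂ (_ , h∈T₊)) = h∈T₊
    T⇒T₊ (inj₁ (g-o⁺ , _)) = contradiction g≲g⁻¹ (⋨⇒≵ g-o⁺)

proposition3p17 :
  ∀ {c ℓ r p : Level} →
  ExcludedMiddle (c ⊔ ℓ ⊔ r ⊔ p) →
  (G : Group c ℓ) (let open Group G) →
  (_≲_ : Rel Carrier r) (let open ElementTypes G _≲_) →
  IsCQuasiOrder G _≲_ →
  (g : Carrier) → ¬ (g ≈ ε) → OType g →
  Σ (IsSubgroup G (G↑ g)) λ G↑-isSubgroup →
    IsSubgroup G (G↓ g) ×
    Convex (G↑ g) ×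
    (let K   = subgroup G G↑-isSubgroup
         _≲K_ : Rel (Group.Carrier K) r
         _≲K_ = _≲_ on proj₁
         G↓K : Pred (Group.Carrier K) r
         G↓K = λ x → proj₁ x ∈ G↓ g
     in HasOrderTypeQuotient K _≲K_ G↓K ×
        ((N : Pred (Group.Carrier K) p) →
         HasOrderTypeQuotient K _≲K_ N → G↓K ⊆ N))
proposition3p17 {c} {ℓ} {r} {p} em G _≲_ isCQuasiOrder g g≉ε g-oType =
  U-isSubgroup , V-isSubgroup , U-convex , hasOrderTypeQuotient ,
  λ N N-hasOrderTypeQuotient → Smallest.V⊆M em-ℓ em-p N-hasOrderTypeQuotient
  where
  em-ℓ : ExcludedMiddle ℓ
  em-ℓ = lower-em (c ⊔ r ⊔ p) em

  em-r : ExcludedMiddle r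
  em-r = lower-em (c ⊔ ℓ ⊔ p) em

  em-p : ExcludedMiddle p
  em-p = lower-em (c ⊔ ℓ ⊔ r) em

  open Sign em-r G _≲_ isCQuasiOrder
  open PositiveRepresentative (positiveRepresentative g≉ε g-oType)
  open PositiveElement G _≲_ isCQuasiOrder em-r k k-o⁺
  open Quotient G↑≐ G↓≐
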